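{- For all natural numbers $m,k,r$ with $k\ge 1$ there exists a natural number $n$ such that for every coloring $c:\mathrm{FIN}_k(n)\to\{0,1,\ldots,r-1\}$ there exists a block sequence $(f_i)_{i<m}$ of length $m$ of elements of $\mathrm{FIN}_k(n)$ such that $c$ is constant on the combinatorial space $\langle f_i\rangle_{i<m}$ generated by $(f_i)_{i<m}$.
   Context: $\mathbb{N}$ is the set of natural numbers starting at $0$. For $k\ge 1$, $\mathrm{FIN}_k$ is the set of all functions $f:\mathbb{N}\to\{0,1,\ldots,k\}$ that attain the maximum value $k$ and whose support $\mathrm{supp}(f)=\{n\in\mathbb{N}: f(n)\neq 0\}$ is finite. For $n\in\mathbb{N}$, $\mathrm{FIN}_k(n)=\{f\in\mathrm{FIN}_k:\max(\mathrm{supp}(f))<n\}$. For $f,g\in\mathrm{FIN}_k$ write $f<g$ if $\max(\mathrm{supp}(f))<\min(\mathrm{supp}(g))$. A block sequence of length $m$ is a sequence $(f_i)_{i<m}$ (indexed by $0\le i<m$) of elements of $\mathrm{FIN}_k$ with $f_i<f_j$ for all $i<j<m$. The tetris operation $T$ is defined pointwise by $(Tf)(x)=\max\{0,f(x)-1\}$, and $T^l$ is its $l$-th iterate ($T^0$ is the identity); sums of functions are pointwise. The combinatorial space $\langle f_i\rangle_{i<m}$ generated by a block sequence $(f_i)_{i<m}$ is the set of all functions of the form $T^{l_0}(f_{i_0})+\cdots+T^{l_{p-1}}(f_{i_{p-1}})$ with $p\ge 1$, $i_0<\cdots<i_{p-1}<m$, $l_0,\ldots,l_{p-1}\in\mathbb{N}$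 and $\min\{l_0,\ldots,l_{p-1}\}=0$. -}

module Defs where

open import Algebra.Properties.Monoid.Sum using (sum)
open import Data.Fin.Base as Fin using (Fin)
open import Data.List.Base using (List)
open import Data.List.Membership.Propositional using (_∈_)
open import Data.Nat.Base using (ℕ; _≤_; _<_; _≥_; _∸_)
open import Data.Nat.GeneralisedArithmetic using (fold)
open import Data.Nat.Properties using (+-0-monoid)
open import Data.Product.Base using (∃-syntax; Σ-syntax; _×_)
open import Function.Bundles using (Func)
open import Level using (0ℓ)
open import Relation.Binary.Bundles using (Setoid)
import Relation.Binary.Construct.On as On
open import Relation.Binary.PropositionalEquality
  using (_≡_; _≢_; _→-setoid_; setoid)
open import Relation.Unary using (Pred; _⊆_)

IsMax : Pred ℕ 0ℓ → ℕ → Set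
IsMax S a = S a × (∀ x → S x → x ≤ a)

IsMin : Pred ℕ 0ℓ → ℕ → Set
IsMin S a = S a × (∀ x → S x → a ≤ x)

supp : (ℕ → ℕ) → Pred ℕ 0ℓ
supp f x = f x ≢ 0

-- Functions ℕ → {0,…,k} are represented as ℕ-valued functions bounded by k, so
-- that pointwise sums need no coercions.
record FIN (k : ℕ) : Set where
  field
    fun      : ℕ → ℕ
    bounded  : ∀ x → fun x ≤ k
    attained : ∃[ x ] fun x ≡ k
    finite   : Σ[ xs ∈ List ℕ ] supp fun ⊆ (_∈ xs)

open FIN public

_≺_ : ∀ {k} → FIN k → FIN k → Set
f ≺ g = ∃[ a ] ∃[ b ] IsMax (supp (fun f)) a × IsMin (supp (fun g)) b × a < b

record FIN< (k n : ℕ) : Set where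
  field
    elem  : FIN k
    max<n : ∃[ a ] IsMax (supp (fun elem)) a × a < n

open FIN< public

-- Elements are identified when their underlying functions agree pointwise.
FIN<-setoid : ℕ → ℕ → Setoid 0ℓ 0ℓ
FIN<-setoid k n = On.setoid (ℕ →-setoid ℕ) (λ (f : FIN< k n) → fun (elem f))

-- A colouring depends only on the function ℕ → {0,…,k}, not on the evidence that
-- it lies in FIN k; without function extensionality this has to be imposed.
Colouring : ℕ → ℕ → ℕ → Set
Colouring k n r = Func (FIN<-setoid k n) (setoid (Fin r))

IsBlockSequence : ∀ {k m} → (Fin m → FIN k) → Set
IsBlockSequence f = ∀ i j → i Fin.< j → f i ≺ f j

T : (ℕ → ℕ) → (ℕ → ℕ)
T f x = f x ∸ 1

T^ : ℕ → (ℕ → ℕ) → (ℕ → ℕ)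
T^ l f = fold f T l

record ⟨_⟩ {k m} (f : Fin m → FIN k) (g : ℕ → ℕ) : Set where
  field
    p          : ℕ
    p≥1        : p ≥ 1
    i          : Fin p → Fin m
    increasing : ∀ a b → a Fin.< b → i a Fin.< i b
    l          : Fin p → ℕ
    min-l≡0    : IsMin (λ x → ∃[ a ] l a ≡ x) 0
    is-sum     : ∀ x → g x ≡ sum +-0-monoid (λ a → T^ (l a) (fun (f (i a))) x)

-- For a block sequence f in FIN< k n every member of ⟨ f ⟩ lies in FIN< k n, so
-- letting g and h range over the domain of c loses no member of S = ⟨ f ⟩.
IsConstantOn : ∀ {k n r} → Colouring k n r → Pred (ℕ → ℕ) 0ℓ → Set
IsConstantOn {k} {n} c S = (g h : FIN< k n) → S (fun (elem g)) → S (fun (elem h)) →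
                           Func.to c g ≡ Func.to c h

module Submission where

-- A factor of a word is a block of consecutive letters.  By induction on k there is, for each r-colouring of
-- the words over {0,…,k}, a block sequence on whose space the colour does not change when a factor with
-- maximum k−1 is replaced by another one of the same length: the theorem for k−1 makes the colour constant on
-- one class of factors, and a fusion handles all factors.  Each block is then replaced by a triple with letters
-- k−1, k, k−1, which leaves the colour dependent only on the set of positions of k, and the case k = 1 applies.
-- The case k = 1 uses the same fusion, with words having exactly one letter 1 as factors and the pigeonhole
-- principle in place of the induction hypothesis: the colour then depends only on the number of letters 1, and
-- Folkman's theorem on sums of integers applies.  The latter follows from Hilbert's cube lemma: iterating it
-- gives numbers for which the colour of a sum depends only on its first term.

open import Defs
open import Algebra.Properties.Monoid.Sum using () renaming (sum to sumᶠ)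
open import Data.Fin.Base as Fin using (Fin; zero; suc; toℕ; fromℕ<; funToFin)
open import Data.Fin.Properties as Fin using (any?; combine-injective; finToFun-funToFin; pigeonhole; toℕ-fromℕ<)
open import Data.List.Base
  using (List; []; _∷_; [_]; _++_; _∷ʳ_; allFin; concat; length; lookup; map; replicate; tabulate; take; upTo)
open import Data.List.Membership.Propositional using (_∈_)
open import Data.List.Membership.Propositional.Properties
  using (∈-allFin; ∈-map⁺; ∈-tabulate⁺; ∈-upTo⁺; ∈-++⁺ˡ; ∈-++⁺ʳ)
open import Data.List.Properties hiding (sum-++)
open import Data.List.Relation.Binary.Sublist.Propositional using (_⊆_; []; _∷_; minimum; ⊆-trans)
  renaming (_∷ʳ_ to _drop∷_; lookup to ⊆-lookup)
open import Data.List.Relation.Unary.All as All using (All; []; _∷_)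
import Data.List.Relation.Unary.All.Properties as All
open import Data.List.Relation.Unary.Any using (here; there)
open import Data.Nat.Base
open import Data.Nat.ListAction using (sum)
open import Data.Nat.ListAction.Properties using (sum-++)
open import Data.Nat.Properties
open import Data.List.Membership.DecPropositional _≟_ using (_∈?_)
open import Data.Product.Base using (Σ-syntax; ∃₂; ∃-syntax; _×_; _,_; proj₁; proj₂)
open import Data.Sum.Base using (_⊎_; inj₁; inj₂)
open import Function.Base using (_∘_)
open import Function.Bundles using (Func)
open import Level using (0ℓ)
open import Relation.Binary.Construct.Closure.ReflexiveTransitive using (Star; ε; _◅_; _◅◅_; gmap)
open import Relation.Binary.Core using (Rel)
open import Relation.Binary.Definitions using (DecidableEquality; tri<; tri≈; tri>)
open import Relation.Binary.PropositionalEquality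
  using (_≡_; _≢_; refl; sym; trans; cong; cong₂; subst; subst₂; module ≡-Reasoning)
open import Relation.Nullary using (yes; no; Dec; _×-dec_; contradiction)
open import Relation.Unary using (Pred)

-- Substitution of words into blocks

Word : Set
Word = List ℕ

shift : ℕ → Word → Word
shift t = map (_∸ t)

-- Words over the alphabet {0,…,k} represent functions; F = (f₀ , f₁ , …) is a list of consecutive
-- blocks, and act k F w is the function Σ T^(k − wᵢ) fᵢ.
act : ℕ → List Word → Word → Word
act k [] w = []
act k (b ∷ F) [] = []
act k (b ∷ F) (a ∷ w) = shift (k ∸ a) b ++ act k F w

length-act : ∀ k F w → length F ≡ length w → length (act k F w) ≡ length (concat F)
length-act k [] w eq = refl
length-act k (b ∷ F) (a ∷ w) eq = begin
  length (shift (k ∸ a) b ++ act k F w)          ≡⟨ length-++ (shift (k ∸ a) b) ⟩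
  length (shift (k ∸ a) b) + length (act k F w)  ≡⟨ cong₂ _+_ (length-map _ b) (length-act k F w (suc-injective eq)) ⟩
  length b + length (concat F)                   ≡⟨ length-++ b ⟨
  length (b ++ concat F)                         ∎
  where open ≡-Reasoning

act-++ : ∀ k F {F′} w {w′} → length F ≡ length w → act k (F ++ F′) (w ++ w′) ≡ act k F w ++ act k F′ w′
act-++ k [] [] eq = refl
act-++ k (b ∷ F) (a ∷ w) eq =
  trans (cong (shift (k ∸ a) b ++_) (act-++ k F w (suc-injective eq))) (sym (++-assoc (shift (k ∸ a) b) _ _))

Bounded : ℕ → Pred Word 0ℓ
Bounded k = All (_≤ k)

-- For `t ≤ x` both sides lower `y` by `k ∸ x + t`; for `x ≤ t` both are 0 because `y ≤ k`. With `y`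
-- a letter of a block, this says pointwise that the tetris operation commutes with substitution.
∸∸-swap : ∀ {k x y} t → x ≤ k → y ≤ k → (y ∸ (k ∸ x)) ∸ t ≡ y ∸ (k ∸ (x ∸ t))
∸∸-swap {k} {x} {y} t x≤k y≤k with ≤-total t x
... | inj₁ t≤x = begin
  (y ∸ (k ∸ x)) ∸ t  ≡⟨ ∸-+-assoc y (k ∸ x) t ⟩
  y ∸ (k ∸ x + t)    ≡⟨ cong (y ∸_) (+-∸-comm t x≤k) ⟨
  y ∸ (k + t ∸ x)    ≡⟨ cong (λ z → y ∸ (z ∸ x)) (+-comm k t) ⟩
  y ∸ (t + k ∸ x)    ≡⟨ cong (λ z → y ∸ (t + k ∸ z)) (m+[n∸m]≡n t≤x) ⟨
  y ∸ (t + k ∸ (t + (x ∸ t))) ≡⟨ cong (y ∸_) ([m+n]∸[m+o]≡n∸o t k (x ∸ t)) ⟩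
  y ∸ (k ∸ (x ∸ t))  ∎
  where open ≡-Reasoning
... | inj₂ x≤t = begin
  (y ∸ (k ∸ x)) ∸ t  ≡⟨ ∸-+-assoc y (k ∸ x) t ⟩
  y ∸ (k ∸ x + t)    ≡⟨ m≤n⇒m∸n≡0 (≤-trans y≤k (≤-trans (≤-reflexive (sym (m∸n+n≡m x≤k)))
                                                         (+-monoʳ-≤ (k ∸ x) x≤t))) ⟩
  0                  ≡⟨ m≤n⇒m∸n≡0 y≤k ⟨
  y ∸ k              ≡⟨ cong (λ z → y ∸ (k ∸ z)) (m≤n⇒m∸n≡0 x≤t) ⟨
  y ∸ (k ∸ (x ∸ t))  ∎
  where open ≡-Reasoning

shift-act : ∀ {k} t {F w} → All (Bounded k) F → Bounded k w → shift t (act k F w) ≡ act k F (shift t w)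
shift-act t {[]} [] pw = refl
shift-act t {b ∷ F} (pb ∷ pF) [] = refl
shift-act {k} t {b ∷ F} {a ∷ w} (pb ∷ pF) (pa ∷ pw) = begin
  shift t (shift (k ∸ a) b ++ act k F w)           ≡⟨ map-++ (_∸ t) (shift (k ∸ a) b) _ ⟩
  shift t (shift (k ∸ a) b) ++ shift t (act k F w) ≡⟨ cong₂ _++_ (block pb) (shift-act t pF pw) ⟩
  shift (k ∸ (a ∸ t)) b ++ act k F (shift t w)     ∎
  where
  open ≡-Reasoning
  block : ∀ {b} → Bounded k b → shift t (shift (k ∸ a) b) ≡ shift (k ∸ (a ∸ t)) b
  block [] = refl
  block (py ∷ pb) = cong₂ _∷_ (∸∸-swap t pa py) (block pb)

split : ∀ {A : Set} a {b} (xs : List A) → length xs ≡ a + b →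
        ∃₂ λ ys zs → xs ≡ ys ++ zs × length ys ≡ a × length zs ≡ b
split zero xs eq = [] , xs , refl , refl , eq
split (suc a) (x ∷ xs) eq with split a xs (suc-injective eq)
... | ys , zs , refl , p , q = x ∷ ys , zs , refl , cong suc p , q

-- `V` is a parameter because the fusion is run with two kinds of blocks: words with exactly one
-- letter 1, and words with maximum `k`.
record Subspace (k : ℕ) (V : Pred Word 0ℓ) (m n : ℕ) : Set where
  constructor subspace
  field
    blocks : List Word
    dim    : length blocks ≡ m
    size   : length (concat blocks) ≡ n
    valid  : All V blocks

open Subspace

Closed : ℕ → (V X : Pred Word 0ℓ) → Set
Closed k V X = ∀ {F} w → All V F → length F ≡ length w → X w → X (act k F w)

_∙_ : ∀ {k V m n} → Subspace k V m n → Word → Word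
_∙_ {k} F w = act k (blocks F) w

length-∙ : ∀ {k V m n} (F : Subspace k V m n) w → length w ≡ m → length (F ∙ w) ≡ n
length-∙ {k} F w eq = trans (length-act k (blocks F) w (trans (dim F) (sym eq))) (size F)

∙-closed : ∀ {k V X m n} → Closed k V X → (F : Subspace k V m n) → ∀ w → length w ≡ m → X w → X (F ∙ w)
∙-closed {X = X} cl F w eq = cl w (valid F) (trans (dim F) (sym eq))

map-valid : ∀ {k V V′ m n} → (∀ {b} → V b → V′ b) → Subspace k V m n → Subspace k V′ m n
map-valid f F = subspace (blocks F) (dim F) (size F) (All.map f (valid F))

-- The blocks of `G` are grouped along those of `F`: a block `b` of `F` takes the next `length b`
-- blocks of `G` and becomes `act k G₁ b`. Substituting a letter into this block is compatible with
-- the grouping by `shift-act`.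
compose : ∀ {k V} → (∀ {b} → V b → Bounded k b) → Closed k V V → ∀ {l m n} →
          (G : Subspace k V m n) (F : Subspace k V l m) →
          Σ[ H ∈ Subspace k V l n ] (∀ w → length w ≡ l → H ∙ w ≡ G ∙ (F ∙ w))
compose {k} {V} bd cl (subspace G refl refl vG) (subspace F refl eq vF) = go F G vF vG (sym eq)
  where
  go : ∀ F G → All V F → All V G → length G ≡ length (concat F) →
       Σ[ H ∈ Subspace k V (length F) (length (concat G)) ]
         (∀ w → length w ≡ length F → H ∙ w ≡ act k G (act k F w))
  go [] [] _ _ _ = subspace [] refl refl [] , λ _ _ → refl
  go (b ∷ F) G (vb ∷ vF) vG eq with split (length b) G (trans eq (length-++ b))
  ... | G₁ , G₂ , refl , eq₁ , eq₂ with All.++⁻ˡ G₁ vG | All.++⁻ʳ G₁ vG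
  ...   | vG₁ | vG₂ with go F G₂ vF vG₂ eq₂
  ...     | H , hom =
    subspace (act k G₁ b ∷ blocks H) (cong suc (dim H)) size′ (cl b vG₁ eq₁ vb ∷ valid H) , hom′
    where
    open ≡-Reasoning
    size′ : length (concat (act k G₁ b ∷ blocks H)) ≡ length (concat (G₁ ++ G₂))
    size′ = begin
      length (act k G₁ b ++ concat (blocks H))         ≡⟨ length-++ (act k G₁ b) ⟩
      length (act k G₁ b) + length (concat (blocks H)) ≡⟨ cong₂ _+_ (length-act k G₁ b eq₁) (size H) ⟩
      length (concat G₁) + length (concat G₂)          ≡⟨ length-++ (concat G₁) ⟨
      length (concat G₁ ++ concat G₂)                  ≡⟨ cong length (concat-++ G₁ G₂) ⟩
      length (concat (G₁ ++ G₂))                       ∎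
    hom′ : ∀ w → length w ≡ suc (length F) →
           act k (act k G₁ b ∷ blocks H) w ≡ act k (G₁ ++ G₂) (act k (b ∷ F) w)
    hom′ (a ∷ w) e = begin
      shift (k ∸ a) (act k G₁ b) ++ act k (blocks H) w
        ≡⟨ cong₂ _++_ (shift-act (k ∸ a) (All.map bd vG₁) (bd vb)) (hom w (suc-injective e)) ⟩
      act k G₁ (shift (k ∸ a) b) ++ act k G₂ (act k F w)
        ≡⟨ act-++ k G₁ (shift (k ∸ a) b) (trans eq₁ (sym (length-map _ b))) ⟨
      act k (G₁ ++ G₂) (shift (k ∸ a) b ++ act k F w) ∎

-- Homogeneous subspaces and fusion

Arrow : ℕ → Pred Word 0ℓ → Rel Word 0ℓ → Set
Arrow k V R = ∀ m r → ∃[ n ] ((c : Word → Fin r) → Σ[ F ∈ Subspace k V m n ]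
  (∀ {w w′} → length w ≡ m → R w w′ → c (F ∙ w) ≡ c (F ∙ w′)))

Both : Pred Word 0ℓ → Rel Word 0ℓ
Both X w w′ = X w × X w′ × length w ≡ length w′

-- Passing through prefixes lets the fusion run twice: letters are split off at the right end for
-- `Prefix` and at the left end for `Factor`.
data Prefix (X : Pred Word 0ℓ) : Rel Word 0ℓ where
  whole : ∀ {w w′} → Both X w w′ → Prefix X w w′
  snoc  : ∀ {w w′} a → Prefix X w w′ → Prefix X (w ∷ʳ a) (w′ ∷ʳ a)

data Factor (X : Pred Word 0ℓ) : Rel Word 0ℓ where
  front : ∀ {w w′} → Prefix X w w′ → Factor X w w′
  cons  : ∀ {w w′} a → Factor X w w′ → Factor X (a ∷ w) (a ∷ w′)

prefix-++ : ∀ {X w w′} v → Prefix X w w′ → Prefix X (w ++ v) (w′ ++ v)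
prefix-++ {X} {w} {w′} [] p = subst₂ (Prefix X) (sym (++-identityʳ w)) (sym (++-identityʳ w′)) p
prefix-++ {X} {w} {w′} (a ∷ v) p =
  subst₂ (Prefix X) (++-assoc w [ a ] v) (++-assoc w′ [ a ] v) (prefix-++ v (snoc a p))

prefix-length : ∀ {X w w′} → Prefix X w w′ → length w ≡ length w′
prefix-length (whole (_ , _ , eq)) = eq
prefix-length (snoc {w} {w′} a p) =
  trans (length-++ w) (trans (cong (_+ 1) (prefix-length p)) (sym (length-++ w′)))

factor-length : ∀ {X w w′} → Factor X w w′ → length w ≡ length w′
factor-length (front p) = prefix-length p
factor-length (cons a p) = cong suc (factor-length p)

-- A family of colourings indexed by letters is one colouring with r ^ suc k colours.
decode : ∀ {k r} {φ ψ : ℕ → Fin r} →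
         funToFin {suc k} (φ ∘ toℕ) ≡ funToFin {suc k} (ψ ∘ toℕ) → ∀ {a} → a ≤ k → φ a ≡ ψ a
decode {k} {r} {φ} {ψ} eq {a} a≤k = begin
  φ a                                ≡⟨ cong φ (toℕ-fromℕ< (s≤s a≤k)) ⟨
  φ (toℕ i)                          ≡⟨ finToFun-funToFin (φ ∘ toℕ) i ⟨
  Fin.finToFun {r} {suc k} (funToFin {suc k} (φ ∘ toℕ)) i ≡⟨ cong (λ z → Fin.finToFun {r} {suc k} z i) eq ⟩
  Fin.finToFun {r} {suc k} (funToFin {suc k} (ψ ∘ toℕ)) i ≡⟨ finToFun-funToFin (ψ ∘ toℕ) i ⟩
  ψ (toℕ i)                          ≡⟨ cong ψ (toℕ-fromℕ< (s≤s a≤k)) ⟩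
  ψ a                                ∎
  where
  open ≡-Reasoning
  i = fromℕ< (s≤s a≤k)

-- Induction on the length: G settles the factors that reach a fixed end of the word; for the others the
-- letter at that end is split off, and the rest is coloured for all values of this letter at once.
module Fusion {k V X} (V-bounded : ∀ {b} → V b → Bounded k b) (V-closed : Closed k V V)
              (X-closed : Closed k V X) (V-letter : V [ k ]) where

  private
    empty : Subspace k V 0 0
    empty = subspace [] refl refl []

    _▷letter : ∀ {m n} → Subspace k V m n → Subspace k V (suc m) (suc n)
    (F ▷letter) = subspace (blocks F ∷ʳ [ k ])
      (trans (length-++ (blocks F)) (trans (cong (_+ 1) (dim F)) (+-comm _ 1)))
      (trans (cong length (sym (concat-++ (blocks F) [ [ k ] ])))
        (trans (length-++ (concat (blocks F))) (trans (cong (_+ 1) (size F)) (+-comm _ 1))))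
      (All.++⁺ (valid F) (V-letter ∷ []))

    letter◁ : ∀ {m n} → Subspace k V m n → Subspace k V (suc m) (suc n)
    letter◁ F = subspace ([ k ] ∷ blocks F) (cong suc (dim F)) (cong suc (size F)) (V-letter ∷ valid F)

    -- The last letter comes back as `k ∸ (k ∸ a)`. This is at most `k` for every `a`, so `decode`
    -- applies without any bound on the words.
    ▷letter-∙ : ∀ {m n} (F : Subspace k V m n) w a → length w ≡ m →
                (F ▷letter) ∙ (w ∷ʳ a) ≡ (F ∙ w) ∷ʳ (k ∸ (k ∸ a))
    ▷letter-∙ F w a eq = act-++ k (blocks F) w (trans (dim F) (sym eq))

    snoc-length : ∀ (w : Word) {a m} → length (w ∷ʳ a) ≡ suc m → length w ≡ m
    snoc-length w eq = suc-injective (trans (+-comm 1 _) (trans (sym (length-++ w)) eq))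

    both-closed : ∀ {m n} (F : Subspace k V m n) {w w′} → length w ≡ m →
                  Both X w w′ → Both X (F ∙ w) (F ∙ w′)
    both-closed F {w} {w′} eq (x , x′ , e) =
      ∙-closed X-closed F w eq x , ∙-closed X-closed F w′ eq′ x′ ,
      trans (length-∙ F w eq) (sym (length-∙ F w′ eq′))
      where eq′ = trans (sym e) eq

    -- Letters after the replaced prefix agree in both words, so their blocks produce equal tails;
    -- the blocks before them are handled by induction.
    prefix-closed : ∀ {m n} (F : Subspace k V m n) {w w′} → length w ≡ m →
                    Prefix X w w′ → Prefix X (F ∙ w) (F ∙ w′)
    prefix-closed F eq (whole p) = whole (both-closed F eq p)
    prefix-closed {m} F eq (snoc {w} {w′} a p)
      with split (length w) (blocks F) (trans (dim F) (trans (sym eq) (length-++ w)))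
    ... | F₁ , F₂ , e , e₁ , _ with valid F
    ... | vF rewrite e | act-++ k F₁ {F₂} w {[ a ]} e₁
                       | act-++ k F₁ {F₂} w′ {[ a ]} (trans e₁ (prefix-length p)) =
      prefix-++ _ (prefix-closed (subspace F₁ refl refl (All.++⁻ˡ F₁ vF)) (sym e₁) p)

  to-prefix : Arrow k V (Both X) → Arrow k V (Prefix X)
  to-prefix both zero r = 0 , λ c → empty , λ _ _ → refl
  to-prefix both (suc m) r with to-prefix both m (r ^ suc k)
  ... | n′ , rec with both (suc n′) r
  ...   | n , arrow = n , λ c →
    let (G , homG) = arrow c
        (F , homF) = rec (λ w → funToFin {suc k} (λ a → c (G ∙ (w ∷ʳ toℕ a))))
        (H , H≡) = compose V-bounded V-closed G (F ▷letter)
        hom : ∀ w w′ → length w ≡ suc m → Prefix X w w′ → c (H ∙ w) ≡ c (H ∙ w′)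
        hom = λ where
          w w′ eq (whole p) →
            trans (cong c (H≡ w eq)) (trans
              (homG (length-∙ (F ▷letter) w eq) (both-closed (F ▷letter) eq p))
              (sym (cong c (H≡ w′ (trans (sym (proj₂ (proj₂ p))) eq)))))
          _ _ eq (snoc {w} {w′} a p) →
            let e = snoc-length w eq
                e′ = trans (sym (prefix-length p)) e
                eq′ = trans (sym (prefix-length (snoc a p))) eq in
            trans (cong c (trans (H≡ (w ∷ʳ a) eq) (cong (G ∙_) (▷letter-∙ F w a e)))) (trans
              (decode {k} {φ = λ a → c (G ∙ ((F ∙ w) ∷ʳ a))} {ψ = λ a → c (G ∙ ((F ∙ w′) ∷ʳ a))}
                (homF e p) (m∸n≤m k (k ∸ a)))
              (sym (cong c (trans (H≡ (w′ ∷ʳ a) eq′) (cong (G ∙_) (▷letter-∙ F w′ a e′))))))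
    in H , λ {w} {w′} → hom w w′

  to-factor : Arrow k V (Prefix X) → Arrow k V (Factor X)
  to-factor pre zero r = 0 , λ c → empty , λ _ _ → refl
  to-factor pre (suc m) r with to-factor pre m (r ^ suc k)
  ... | n′ , rec with pre (suc n′) r
  ...   | n , arrow = n , λ c →
    let (G , homG) = arrow c
        (F , homF) = rec (λ w → funToFin {suc k} (λ a → c (G ∙ (toℕ a ∷ w))))
        (H , H≡) = compose V-bounded V-closed G (letter◁ F)
        hom : ∀ w w′ → length w ≡ suc m → Factor X w w′ → c (H ∙ w) ≡ c (H ∙ w′)
        hom = λ where
          w w′ eq (front p) →
            trans (cong c (H≡ w eq)) (trans
              (homG (length-∙ (letter◁ F) w eq) (prefix-closed (letter◁ F) eq p))
              (sym (cong c (H≡ w′ (trans (sym (prefix-length p)) eq)))))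
          _ _ eq (cons {w} {w′} a p) →
            trans (cong c (H≡ (a ∷ w) eq)) (trans
              (decode {k} {φ = λ a → c (G ∙ (a ∷ (F ∙ w)))} {ψ = λ a → c (G ∙ (a ∷ (F ∙ w′)))}
                (homF (suc-injective eq) p) (m∸n≤m k (k ∸ a)))
              (sym (cong c (H≡ (a ∷ w′) (trans (sym (factor-length (cons a p))) eq)))))
    in H , λ {w} {w′} → hom w w′

-- The pigeonhole principle and the words with one letter 1

module _ {A : Set} (_≟ᴬ_ : DecidableEquality A) where

  -- All occurrences of `q` are deleted: either there are at least `m` of them, or the deletion
  -- costs at most `m` entries.
  separate : ∀ q m (xs : List A) → replicate m q ⊆ xs ⊎
             ∃[ ys ] ys ⊆ xs × All (_≢ q) ys × length xs ≤ length ys + m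
  separate q zero xs = inj₁ (minimum xs)
  separate q (suc m) [] = inj₂ ([] , [] , [] , z≤n)
  separate q (suc m) (x ∷ xs) with x ≟ᴬ q
  ... | yes refl with separate q m xs
  ...   | inj₁ p = inj₁ (refl ∷ p)
  ...   | inj₂ (ys , p , ≢q , le) =
    inj₂ (ys , x drop∷ p , ≢q , ≤-trans (s≤s le) (≤-reflexive (sym (+-suc _ m))))
  separate q (suc m) (x ∷ xs) | no x≢q with separate q (suc m) xs
  ...   | inj₁ p = inj₁ (x drop∷ p)
  ...   | inj₂ (ys , p , ≢q , le) = inj₂ (x ∷ ys , refl ∷ p , x≢q ∷ ≢q , s≤s le)

  -- Each colour that does not occur `m` times is removed at a cost of at most `m` entries. The
  -- conclusion is a sublist because later arguments select positions along it.
  repeated : ∀ m qs (xs : List A) → All (_∈ qs) xs → length qs * m < length xs →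
             ∃[ q ] replicate m q ⊆ xs
  repeated m [] (x ∷ xs) (() ∷ _) _
  repeated m (q ∷ qs) xs all lt with separate q m xs
  ... | inj₁ p = q , p
  ... | inj₂ (ys , ys⊆xs , ≢q , le) =
    let (q′ , p) = repeated m qs ys (All.tabulate other) lt′ in q′ , ⊆-trans p ys⊆xs
    where
    other : ∀ {y} → y ∈ ys → y ∈ qs
    other y∈ys with All.lookup all (⊆-lookup ys⊆xs y∈ys)
    ... | here refl = contradiction refl (All.lookup ≢q y∈ys)
    ... | there y∈qs = y∈qs
    lt′ : length qs * m < length ys
    lt′ = +-cancelʳ-< m _ _ (<-≤-trans (subst (_< length xs) (+-comm m _) lt) le)

repeated-colour : ∀ {r} m (xs : List (Fin r)) → length xs ≡ suc (r * m) → ∃[ q ] replicate m q ⊆ xs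
repeated-colour {r} m xs eq = repeated Fin._≟_ m (allFin r) xs (All.tabulate (λ {x} _ → ∈-allFin x))
  (≤-reflexive (trans (cong (λ z → suc (z * m)) (length-tabulate {n = r} (λ i → i))) (sym eq)))

data Zeros : Pred Word 0ℓ where
  []  : Zeros []
  0∷_ : ∀ {w} → Zeros w → Zeros (0 ∷ w)

data One : Pred Word 0ℓ where
  here  : ∀ {w} → Zeros w → One (1 ∷ w)
  there : ∀ {w} → One w → One (0 ∷ w)

zeros-++ : ∀ {v w} → Zeros v → Zeros w → Zeros (v ++ w)
zeros-++ [] z = z
zeros-++ (0∷ y) z = 0∷ zeros-++ y z

zeros-replicate : ∀ n → Zeros (replicate n 0)
zeros-replicate zero = []
zeros-replicate (suc n) = 0∷ zeros-replicate n

zeros-≡ : ∀ {w} → Zeros w → w ≡ replicate (length w) 0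
zeros-≡ [] = refl
zeros-≡ (0∷ z) = cong (0 ∷_) (zeros-≡ z)

zeros-shift : ∀ {t w} → Zeros w → Zeros (shift t w)
zeros-shift [] = []
zeros-shift {t} (0∷ z) rewrite 0∸n≡0 t = 0∷ zeros-shift {t} z

one-zeros : ∀ {v w} → One v → Zeros w → One (v ++ w)
one-zeros (here z) z′ = here (zeros-++ z z′)
one-zeros (there o) z = there (one-zeros o z)

zeros-one : ∀ {v w} → Zeros v → One w → One (v ++ w)
zeros-one [] o = o
zeros-one (0∷ z) o = there (zeros-one z o)

one-shift : ∀ {w} → One w → Zeros (shift 1 w)
one-shift (here z) = 0∷ zeros-shift {1} z
one-shift (there o) = 0∷ one-shift o

one-bounded : ∀ {w} → One w → Bounded 1 w
one-bounded (here z) = ≤-refl ∷ go z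
  where
  go : ∀ {w} → Zeros w → Bounded 1 w
  go [] = []
  go (0∷ z) = z≤n ∷ go z
one-bounded (there o) = z≤n ∷ one-bounded o

shift-0 : ∀ w → shift 0 w ≡ w
shift-0 = map-id

zeros-closed : ∀ {F w} → All One F → Zeros w → Zeros (act 1 F w)
zeros-closed [] z = []
zeros-closed (o ∷ os) [] = []
zeros-closed (o ∷ os) (0∷ z) = zeros-++ (one-shift o) (zeros-closed os z)

one-closed : Closed 1 One One
one-closed {b ∷ F} (1 ∷ w) (o ∷ os) eq (here z) rewrite shift-0 b = one-zeros o (zeros-closed os z)
one-closed (0 ∷ w) (o ∷ os) eq (there p) = zeros-one (one-shift o) (one-closed w os (suc-injective eq) p)

-- These are the colours of the unit words of length `n`, ordered by the position of the letter 1.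
unit-colours : ∀ {r} (n : ℕ) → (Word → Fin r) → List (Fin r)
unit-colours zero c = []
unit-colours (suc n) c = c (1 ∷ replicate n 0) ∷ unit-colours n (c ∘ (0 ∷_))

length-unit-colours : ∀ {r} n (c : Word → Fin r) → length (unit-colours n c) ≡ n
length-unit-colours zero c = refl
length-unit-colours (suc n) c = cong suc (length-unit-colours n (c ∘ (0 ∷_)))

-- Every block starts with a 1 at a selected position and continues with zeros up to the next one,
-- so a word with one letter 1 is sent to a unit word of colour `q`. The `z` zeros before the first
-- selected position belong to no block yet.
select : ∀ {r} n (c : Word → Fin r) m q → replicate m q ⊆ unit-colours n c →
         ∃₂ λ z F → length F ≡ m × z + length (concat F) ≡ n × All One F ×
           (∀ w → One w → length w ≡ m → c (replicate z 0 ++ act 1 F w) ≡ q)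
select n c zero q p = n , [] , refl , +-identityʳ n , [] , λ where [] () _
select (suc n) c (suc m) q (y drop∷ p) with select n (c ∘ (0 ∷_)) (suc m) q p
... | z , F , dimF , sizeF , ones , hom = suc z , F , dimF , cong suc sizeF , ones , hom
select (suc n) c (suc m) q (eq ∷ p) with select n (c ∘ (0 ∷_)) m q p
... | z , F , dimF , sizeF , ones , hom =
  0 , (1 ∷ replicate z 0) ∷ F , cong suc dimF , cong suc size′ , here (zeros-replicate z) ∷ ones , hom′
  where
  size′ : length (replicate z 0 ++ concat F) ≡ n
  size′ = trans (length-++ (replicate z 0)) (trans (cong (_+ length (concat F)) (length-replicate z)) sizeF)
  hom′ : ∀ w → One w → length w ≡ suc m → c (act 1 ((1 ∷ replicate z 0) ∷ F) w) ≡ q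
  hom′ (1 ∷ w) (here zw) e = trans (cong (c ∘ (1 ∷_)) zeros) (sym eq)
    where
    tail = shift 0 (replicate z 0) ++ act 1 F w
    zeros : tail ≡ replicate n 0
    zeros = trans (zeros-≡ (zeros-++ (zeros-shift {0} (zeros-replicate z)) (zeros-closed ones zw)))
      (cong (λ l → replicate l 0) (trans (length-++ (shift 0 (replicate z 0)))
        (trans (cong₂ _+_ (trans (length-map _ (replicate z 0)) (length-replicate z))
                          (length-act 1 F w (trans dimF (sym (suc-injective e))))) sizeF)))
  hom′ (0 ∷ w) (there o) e = trans
    (cong (λ v → c (0 ∷ v ++ act 1 F w)) (trans (map-replicate (_∸ 1) z 0) refl)) (hom w o (suc-injective e))

-- The zeros join the first block, where no shift changes them; hence the dimension `suc m`.
pad : ∀ {k V m n N} z → z + n ≡ N → (∀ {b} → V b → V (replicate z 0 ++ b)) → (F : Subspace k V (suc m) n) →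
      Σ[ H ∈ Subspace k V (suc m) N ] (∀ w → length w ≡ suc m → H ∙ w ≡ replicate z 0 ++ F ∙ w)
pad {k} z refl V-pad (subspace (b ∷ F) refl refl (vb ∷ vF)) =
  subspace ((replicate z 0 ++ b) ∷ F) refl
    (trans (cong length (++-assoc (replicate z 0) b (concat F)))
      (trans (length-++ (replicate z 0)) (cong (_+ _) (length-replicate z))))
    (V-pad vb ∷ vF) ,
  λ where
    (a ∷ w) _ → trans (cong (_++ act k F w) (trans (map-++ (_∸ (k ∸ a)) (replicate z 0) b)
      (cong (_++ shift (k ∸ a) b) (trans (map-replicate (_∸ (k ∸ a)) z 0) (cong (replicate z) (0∸n≡0 (k ∸ a)))))))
      (++-assoc (replicate z 0) (shift (k ∸ a) b) _)

unit-arrow : Arrow 1 One (Both One)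
unit-arrow zero r = 0 , λ c → subspace [] refl refl [] , λ where
  () (here _ , _)
  () (there _ , _)
unit-arrow (suc m) r = n , arrow
  where
  n = suc (r * suc m)
  arrow : (c : Word → Fin r) → Σ[ F ∈ Subspace 1 One (suc m) n ]
          (∀ {w w′} → length w ≡ suc m → Both One w w′ → c (F ∙ w) ≡ c (F ∙ w′))
  arrow c with repeated-colour (suc m) (unit-colours n c) (length-unit-colours n c)
  ... | q , p with select n c (suc m) q p
  ...   | z , F , dimF , sizeF , ones , hom
    with pad z sizeF (zeros-one (zeros-replicate z)) (subspace F dimF refl ones)
  ...     | H , H≡ = H , λ {w} {w′} e (o , o′ , e′) → trans (colour w e o) (sym (colour w′ (trans (sym e′) e) o′))
    where
    colour : ∀ w → length w ≡ suc m → One w → c (H ∙ w) ≡ q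
    colour w e o = trans (cong c (H≡ w e)) (hom w o e)

-- Sorting binary words

sorted : ℕ → ℕ → Word
sorted z s = replicate z 0 ++ replicate s 1

-- The leading 1 passes each 0 by replacing the factor 10 by 01, and both have exactly one letter 1.
insert : ∀ z s → Star (Factor One) (1 ∷ sorted z s) (sorted z (suc s))
insert zero s = ε
insert (suc z) s = front (prefix-++ (sorted z s) (whole (here (0∷ []) , there (here []) , refl)))
  ◅ gmap (0 ∷_) (cons 0) (insert z s)

-- Insertion sort. The bound on `sum w` is proved alongside because a leading 0 must raise the
-- truncated difference by exactly one.
sort : ∀ {w} → Bounded 1 w → Star (Factor One) w (sorted (length w ∸ sum w) (sum w)) × sum w ≤ length w
sort [] = ε , z≤n
sort {0 ∷ w} (_ ∷ p) with sort p
... | st , le rewrite +-∸-assoc 1 le = gmap (0 ∷_) (cons 0) st , m≤n⇒m≤1+n le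
sort {1 ∷ w} (_ ∷ p) with sort p
... | st , le = gmap (1 ∷_) (cons 1) st ◅◅ insert (length w ∸ sum w) (sum w) , s≤s le
sort {suc (suc _) ∷ w} (s≤s () ∷ _)

star-invariant : ∀ {r X m} {c : Word → Fin r} {φ : Word → Word} →
  (∀ {w w′} → length w ≡ m → Factor X w w′ → c (φ w) ≡ c (φ w′)) →
  ∀ {w w′} → length w ≡ m → Star (Factor X) w w′ → c (φ w) ≡ c (φ w′)
star-invariant hom eq ε = refl
star-invariant {c = c} {φ} hom eq (p ◅ ps) =
  trans (hom eq p) (star-invariant {c = c} {φ} hom (trans (sym (factor-length p)) eq) ps)

one-factor : Arrow 1 One (Factor One)
one-factor = to-factor (to-prefix unit-arrow)
  where open Fusion {1} {One} {One} one-bounded one-closed one-closed (here [])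

counting : ∀ m r → ∃[ n ] ((c : Word → Fin r) → Σ[ F ∈ Subspace 1 One m n ]
           (∀ {w} → length w ≡ m → Bounded 1 w → c (F ∙ w) ≡ c (F ∙ sorted (m ∸ sum w) (sum w))))
counting m r with one-factor m r
... | n , arrow = n , λ c →
  let (F , hom) = arrow c in
  F , λ {w} eq p → trans (star-invariant {c = c} {φ = F ∙_} hom eq (proj₁ (sort p)))
    (cong (λ l → c (F ∙ sorted (l ∸ sum w) (sum w))) eq)

-- Sums of integers

-- Sums over sublists, the empty one included.
data Sum : List ℕ → ℕ → Set where
  none : Sum [] 0
  skip : ∀ {x xs s} → Sum xs s → Sum (x ∷ xs) s
  add  : ∀ {x xs s} → Sum xs s → Sum (x ∷ xs) (x + s)

sum-zero : ∀ xs → Sum xs 0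
sum-zero [] = none
sum-zero (x ∷ xs) = skip (sum-zero xs)

sum-all : ∀ xs → Sum xs (sum xs)
sum-all [] = none
sum-all (x ∷ xs) = add (sum-all xs)

sum-join : ∀ {xs ys s t} → Sum xs s → Sum ys t → Sum (xs ++ ys) (s + t)
sum-join none q = q
sum-join (skip p) q = skip (sum-join p q)
sum-join {t = t} (add {x} {s = s} p) q = subst (Sum _) (sym (+-assoc x s t)) (add (sum-join p q))

-- This is r to the power 2^n: one colour for each subset of the `n` entries.
palette : ℕ → ℕ → ℕ
palette zero r = r
palette (suc n) r = palette n r * palette n r

encode : ∀ {r} xs → (ℕ → Fin r) → Fin (palette (length xs) r)
encode [] c = c 0
encode (x ∷ xs) c = Fin.combine (encode xs c) (encode xs (c ∘ (x +_)))

encode-injective : ∀ {r} xs {c d : ℕ → Fin r} → encode xs c ≡ encode xs d → ∀ {s} → Sum xs s → c s ≡ d s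
encode-injective [] eq none = eq
encode-injective (x ∷ xs) {c} {d} eq p
  with combine-injective (encode xs c) (encode xs (c ∘ (x +_))) (encode xs d) _ eq
encode-injective (x ∷ xs) eq (skip p) | eq₁ , _ = encode-injective xs eq₁ p
encode-injective (x ∷ xs) eq (add p)  | _ , eq₂ = encode-injective xs eq₂ p

Positive : List ℕ → Set
Positive = All (1 ≤_)

prefix-sum : List ℕ → ℕ → ℕ
prefix-sum xs i = sum (take i xs)

sum-prefix-sum : ∀ xs i → Sum xs (prefix-sum xs i)
sum-prefix-sum xs zero = sum-zero xs
sum-prefix-sum [] (suc i) = none
sum-prefix-sum (x ∷ xs) (suc i) = add (sum-prefix-sum xs i)

-- The gap `h` is the sum of the entries between the two prefixes, hence itself a sum over a
-- sublist, and it is positive because the entries are.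
prefix-sum-gap : ∀ {xs i j} → Positive xs → i < j → j ≤ length xs →
             ∃[ h ] 1 ≤ h × Sum xs h × Sum xs (prefix-sum xs i + h) × prefix-sum xs i + h ≡ prefix-sum xs j
prefix-sum-gap {x ∷ xs} {zero} {suc j} (px ∷ _) _ _ =
  prefix-sum (x ∷ xs) (suc j) , ≤-trans px (m≤m+n x _) , sum-prefix-sum (x ∷ xs) (suc j) , sum-prefix-sum (x ∷ xs) (suc j) , refl
prefix-sum-gap {x ∷ xs} {suc i} {suc j} (_ ∷ pos) (s≤s i<j) (s≤s le) with prefix-sum-gap pos i<j le
... | h , h≥1 , sh , sih , eq =
  h , h≥1 , skip sh , subst (Sum _) (sym assoc) (add sih) , trans assoc (cong (x +_) eq)
  where
  assoc : x + prefix-sum xs i + h ≡ x + (prefix-sum xs i + h)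
  assoc = +-assoc x (prefix-sum xs i) h

repetition : ∀ {R} xs (f : ℕ → Fin R) → length xs ≡ suc (suc R) → Positive xs →
  ∃₂ λ e h → 1 ≤ e × 1 ≤ h × Sum xs e × Sum xs h × Sum xs (e + h) × f e ≡ f (e + h)
repetition {R} xs@(x ∷ _) f eq pos@(px ∷ _)
  -- The prefixes start at length 1, so that `e` contains the first entry and is positive.
  with pigeonhole (n<1+n R) (λ i → f (prefix-sum xs (suc (toℕ i))))
... | i , j , i<j , fi≡fj with prefix-sum-gap pos (s≤s i<j) (≤-trans (Fin.toℕ<n j) (≤-trans (n≤1+n _) (≤-reflexive (sym eq))))
... | h , h≥1 , sh , seh , e =
  prefix-sum xs (suc (toℕ i)) , h , ≤-trans px (m≤m+n x _) , h≥1 , sum-prefix-sum xs (suc (toℕ i)) , sh , seh ,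
  trans fi≡fj (cong f (sym e))

-- Inclusion of sum sets stands in for the statement that the entries of `xs` are sums over disjoint
-- parts of `ys`.
_⊑_ : List ℕ → List ℕ → Set
xs ⊑ ys = ∀ {s} → Sum xs s → Sum ys s

-- Hilbert's cube lemma, by induction on the dimension. The first part of the list yields `e` and
-- `h` such that shifting by `e` and by `e + h` induces the same colouring on all sums of the
-- remaining entries. A cube found there is shifted by `e` and gains the direction `h`.
cube : ∀ d r → ∃[ n ] (∀ xs (c : ℕ → Fin r) → length xs ≡ n → Positive xs →
       ∃₂ λ a ys → 1 ≤ a × length ys ≡ d × Positive ys × (a ∷ ys) ⊑ xs ×
         (∀ {s} → Sum ys s → c (a + s) ≡ c a))
cube zero r = 1 , λ where
  (x ∷ []) c _ (px ∷ []) → x , [] , px , refl , [] , (λ p → p) , λ where none → cong c (+-identityʳ x)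
cube (suc d) r with cube d r
... | n , rec = suc (suc R) + n , step
  where
  R = palette n r
  step : ∀ xs (c : ℕ → Fin r) → length xs ≡ suc (suc R) + n → Positive xs →
         ∃₂ λ a ys → 1 ≤ a × length ys ≡ suc d × Positive ys × (a ∷ ys) ⊑ xs ×
           (∀ {s} → Sum ys s → c (a + s) ≡ c a)
  step xs c eq pos with split (suc (suc R)) xs eq
  ... | us , vs , refl , eqᵤ , refl
    with repetition us (λ e → encode vs (c ∘ (e +_))) eqᵤ (All.++⁻ˡ us pos)
  ... | e , h , e≥1 , h≥1 , se , sh , seh , same
    with rec vs (c ∘ (e +_)) refl (All.++⁻ʳ us pos)
  ... | a , ys , a≥1 , dys , pys , a∷ys⊑vs , const =
    e + a , h ∷ ys , ≤-trans e≥1 (m≤m+n e a) , cong suc dys , h≥1 ∷ pys , ⊑xs , const′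
    where
    shuffle : ∀ s → e + a + (h + s) ≡ e + h + (a + s)
    shuffle s = trans (+-assoc e a (h + s)) (trans (cong (e +_) (trans (sym (+-assoc a h s))
      (trans (cong (_+ s) (+-comm a h)) (+-assoc h a s)))) (sym (+-assoc e h (a + s))))
    ⊑xs : (e + a ∷ h ∷ ys) ⊑ (us ++ vs)
    ⊑xs (skip (skip p)) = sum-join (sum-zero us) (a∷ys⊑vs (skip p))
    ⊑xs (skip (add p)) = sum-join sh (a∷ys⊑vs (skip p))
    ⊑xs (add (skip {s = s} p)) = subst (Sum _) (sym (+-assoc e a s)) (sum-join se (a∷ys⊑vs (add p)))
    ⊑xs (add (add {s = s} p)) = subst (Sum _) (sym (shuffle s)) (sum-join seh (a∷ys⊑vs (add p)))
    const′ : ∀ {s} → Sum (h ∷ ys) s → c (e + a + s) ≡ c (e + a)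
    const′ {s} (skip p) = trans (cong c (+-assoc e a s)) (const p)
    const′ (add {s = s} p) = begin
      c (e + a + (h + s))  ≡⟨ cong c (shuffle s) ⟩
      c (e + h + (a + s))  ≡⟨ encode-injective vs same (a∷ys⊑vs (add p)) ⟨
      c (e + (a + s))      ≡⟨ const p ⟩
      c (e + a)            ∎
      where open ≡-Reasoning

data Stable {r} (c : ℕ → Fin r) : List ℕ → Set where
  []  : Stable c []
  _∷_ : ∀ {x xs} → (∀ {s} → Sum xs s → c (x + s) ≡ c x) → Stable c xs → Stable c (x ∷ xs)

-- The base point of a cube becomes the first entry. The dimension of the cube is the length that
-- the induction needs, and the remaining entries are found among the sums of its directions.
stable : ∀ m r → ∃[ n ] (∀ xs (c : ℕ → Fin r) → length xs ≡ n → Positive xs →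
         ∃[ ys ] length ys ≡ m × Positive ys × ys ⊑ xs × Stable c ys)
stable zero r = 0 , λ where [] c _ _ → [] , refl , [] , (λ p → p) , []
stable (suc m) r with stable m r
... | d , rec with cube d r
... | n , find = n , step
  where
  step : ∀ xs (c : ℕ → Fin r) → length xs ≡ n → Positive xs →
         ∃[ ys ] length ys ≡ suc m × Positive ys × ys ⊑ xs × Stable c ys
  step xs c eq pos with find xs c eq pos
  ... | a , ys , a≥1 , dys , pys , sub , const with rec ys c dys pys
  ... | zs , dzs , pzs , sub′ , st =
    a ∷ zs , cong suc dzs , a≥1 ∷ pzs ,
    (λ where (skip p) → sub (skip (sub′ p)) ; (add p) → sub (add (sub′ p))) ,
    (λ p → const (sub′ p)) ∷ st

-- In a stable list a nonempty sum has the colour of its first term, so it suffices to keep entries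
-- of colour `q`.
monochromatic : ∀ {r} {c : ℕ → Fin r} {q} m {xs} → Stable c xs → Positive xs → replicate m q ⊆ map c xs →
  ∃[ ys ] length ys ≡ m × Positive ys × ys ⊑ xs × (∀ {s} → Sum ys s → s ≢ 0 → c s ≡ q)
monochromatic zero {xs} st pos p = [] , refl , [] , (λ where none → sum-zero xs) , λ where none s≢0 → contradiction refl s≢0
monochromatic (suc m) (const ∷ st) (px ∷ pos) (_ drop∷ p) with monochromatic (suc m) st pos p
... | ys , dys , pys , sub , mono = ys , dys , pys , skip ∘ sub , mono
monochromatic (suc m) {x ∷ xs} (const ∷ st) (px ∷ pos) (eq ∷ p) with monochromatic m st pos p
... | ys , dys , pys , sub , mono =
  x ∷ ys , cong suc dys , px ∷ pys ,
  (λ where (skip q) → skip (sub q) ; (add q) → add (sub q)) ,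
  λ where (skip q) s≢0 → mono q s≢0 ; (add q) s≢0 → trans (const (sub q)) (sym eq)

-- The list to start from consists of `n` ones: all its sums are at most `n`, which bounds `sum ys`.
folkman : ∀ m r → ∃[ n ] ((c : ℕ → Fin r) → ∃₂ λ ys q → length ys ≡ m × Positive ys × sum ys ≤ n ×
          (∀ {s} → Sum ys s → s ≢ 0 → c s ≡ q))
folkman m r with stable (suc (r * m)) r
... | n , find = n , step
  where
  bound : ∀ n {s} → Sum (replicate n 1) s → s ≤ n
  bound zero none = z≤n
  bound (suc n) (skip p) = m≤n⇒m≤1+n (bound n p)
  bound (suc n) (add p) = s≤s (bound n p)
  step : (c : ℕ → Fin r) → ∃₂ λ ys q → length ys ≡ m × Positive ys × sum ys ≤ n ×
         (∀ {s} → Sum ys s → s ≢ 0 → c s ≡ q)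
  step c with find (replicate n 1) c (length-replicate n) (All.replicate⁺ n ≤-refl)
  ... | xs , dxs , pxs , sub , st with repeated-colour m (map c xs) (trans (length-map c xs) dxs)
  ... | q , p with monochromatic m st pxs p
  ... | ys , dys , pys , sub′ , mono = ys , q , dys , pys , bound n (sub (sub′ (sum-all ys))) , mono

-- Passing from k − 1 to k

-- The word form of membership in `FIN k`.
W : ℕ → Pred Word 0ℓ
W k w = Bounded k w × k ∈ w

bounded-shift : ∀ {k j b} → Bounded k b → j ≤ k → Bounded j (shift (k ∸ j) b)
bounded-shift {k} {j} pb j≤k =
  All.map⁺ (All.map (λ p → ≤-trans (∸-monoˡ-≤ (k ∸ j) p) (≤-reflexive (m∸[m∸n]≡n j≤k))) pb)

bounded-closed : ∀ {j k} → j ≤ k → ∀ {F w} → All (Bounded k) F → Bounded j w → Bounded j (act k F w)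
bounded-closed j≤k [] pw = []
bounded-closed j≤k (pb ∷ pF) [] = []
bounded-closed j≤k (pb ∷ pF) (a≤j ∷ pw) =
  All.++⁺ (All.map (λ p → ≤-trans p a≤j) (bounded-shift pb (≤-trans a≤j j≤k))) (bounded-closed j≤k pF pw)

-- A letter `a ≤ k` turns a block with maximum `k` into one with maximum `a`. The case `j < k` is
-- what the fusion needs for factors with maximum k - 1.
W-closed : ∀ {j k} → j ≤ k → Closed k (W k) (W j)
W-closed {j} {k} j≤k w vF eq (pw , j∈w) = bounded-closed j≤k (All.map proj₁ vF) pw , top vF eq j∈w
  where
  top : ∀ {F w} → All (W k) F → length F ≡ length w → j ∈ w → j ∈ act k F w
  top {b ∷ _} ((_ , k∈b) ∷ vF) eq (here refl) =
    ∈-++⁺ˡ (subst (_∈ shift (k ∸ j) b) (m∸[m∸n]≡n j≤k) (∈-map⁺ (_∸ (k ∸ j)) k∈b))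
  top {b ∷ _} {a ∷ _} (_ ∷ vF) eq (there p) = ∈-++⁺ʳ (shift (k ∸ a) b) (top vF (suc-injective eq) p)

W-letter : ∀ {k} → W k [ k ]
W-letter = ≤-refl ∷ [] , here refl

one-W : ∀ {w} → One w → W 1 w
one-W o = one-bounded o , go o
  where
  go : ∀ {w} → One w → 1 ∈ w
  go (here _) = here refl
  go (there o) = there (go o)

-- The theorem for words: `Both (W k)` relates any two words of equal length with maximum `k`, and
-- these words describe the members of the space.
Gowers : ℕ → Set
Gowers k = Arrow k (W k) (Both (W k))

composeW : ∀ {k l m n} (G : Subspace k (W k) m n) (F : Subspace k (W k) l m) →
           Σ[ H ∈ Subspace k (W k) l n ] (∀ w → length w ≡ l → H ∙ w ≡ G ∙ (F ∙ w))
composeW = compose proj₁ (W-closed ≤-refl)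

ones : List ℕ → List Word
ones = map (λ s → replicate s 1)

length-ones : ∀ xs → length (concat (ones xs)) ≡ sum xs
length-ones [] = refl
length-ones (x ∷ xs) = trans (length-++ (replicate x 1)) (cong₂ _+_ (length-replicate x) (length-ones xs))

sum-replicate : ∀ n a → sum (replicate n a) ≡ n * a
sum-replicate zero a = refl
sum-replicate (suc n) a = cong (a +_) (sum-replicate n a)

replicate-+ : ∀ m n (a : ℕ) → replicate (m + n) a ≡ replicate m a ++ replicate n a
replicate-+ zero n a = refl
replicate-+ (suc m) n a = cong (a ∷_) (replicate-+ m n a)

-- The letter 1 contributes the whole length `x` of its block and the letter 0 contributes nothing.
sum-ones : ∀ xs {w} → Bounded 1 w → length xs ≡ length w → Sum xs (sum (act 1 (ones xs) w))
sum-ones [] [] eq = none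
sum-ones (x ∷ xs) (_∷_ {a} {w} pa pw) eq
  rewrite sum-++ (shift (1 ∸ a) (replicate x 1)) (act 1 (ones xs) w)
        | map-replicate (_∸ (1 ∸ a)) x 1 | sum-replicate x (1 ∸ (1 ∸ a)) = go a pa (sum-ones xs pw (suc-injective eq))
  where
  go : ∀ a {s} → a ≤ 1 → Sum xs s → Sum (x ∷ xs) (x * (1 ∸ (1 ∸ a)) + s)
  go zero _ p rewrite *-zeroʳ x = skip p
  go (suc zero) _ p rewrite *-identityʳ x = add p
  go (suc (suc _)) (s≤s ()) _

valid-ones : ∀ {xs} → Positive xs → All (W 1) (ones xs)
valid-ones = All.map⁺ ∘ All.map λ where (s≤s {n = n} _) → ≤-refl ∷ All.replicate⁺ n ≤-refl , here refl

zeros-W : ∀ {k} z {b} → W k b → W k (replicate z 0 ++ b)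
zeros-W z (pb , k∈b) = All.++⁺ (All.replicate⁺ z z≤n) pb , ∈-++⁺ʳ (replicate z 0) k∈b

∈⇒≤sum : ∀ {a w} → a ∈ w → a ≤ sum w
∈⇒≤sum {w = b ∷ w} (here refl) = m≤m+n b (sum w)
∈⇒≤sum {w = b ∷ w} (there a∈w) = ≤-trans (∈⇒≤sum a∈w) (m≤n+m (sum w) b)

sum-pad : ∀ z w → sum (replicate z 0 ++ w) ≡ sum w
sum-pad zero w = refl
sum-pad (suc z) w = sum-pad z w

-- `counting` makes the colour inside `G` a function of the number of letters 1, and `folkman` makes
-- this function constant on the nonzero sums of `xs`. Blocks of `x` letters 1, for `x` in `xs`,
-- turn words into such sums; zeros fill the length up to `M`.
gowers-1 : Gowers 1
gowers-1 zero r = 0 , λ c → subspace [] refl refl [] , λ where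
  () ((_ , here _) , _)
  () ((_ , there _) , _)
gowers-1 (suc m) r with folkman (suc m) r
... | M , sums with counting M r
... | n , arrow = n , step
  where
  step : (c : Word → Fin r) → Σ[ F ∈ Subspace 1 (W 1) (suc m) n ]
         (∀ {w w′} → length w ≡ suc m → Both (W 1) w w′ → c (F ∙ w) ≡ c (F ∙ w′))
  step c with arrow c
  ... | G , count with sums (λ s → c (G ∙ sorted (M ∸ s) s))
  ... | xs , q , dxs , pxs , le , mono
    with pad (M ∸ sum xs) (m∸n+n≡m le) (zeros-W (M ∸ sum xs))
             (subspace (ones xs) (trans (length-map _ xs) dxs) (length-ones xs) (valid-ones pxs))
  ... | E , E≡ with composeW (map-valid one-W G) E
  ... | H , H≡ = H , λ {w} {w′} eq (p , p′ , e) →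
          trans (colour w eq p) (sym (colour w′ (trans (sym e) eq) p′))
    where
    colour : ∀ w → length w ≡ suc m → W 1 w → c (H ∙ w) ≡ q
    colour w eq p@(pw , _) = trans (cong c (H≡ w eq)) (trans
      (count (length-∙ E w eq) (proj₁ Ew))
      (mono (subst (Sum xs) (sym sum≡) (sum-ones xs pw (trans dxs (sym eq)))) positive))
      where
      Ew : W 1 (E ∙ w)
      Ew = ∙-closed {X = W 1} (W-closed ≤-refl) E w eq p
      positive : sum (E ∙ w) ≢ 0
      positive s≡0 with subst (1 ≤_) s≡0 (∈⇒≤sum (proj₂ Ew))
      ... | ()
      sum≡ : sum (E ∙ w) ≡ sum (act 1 (ones xs) w)
      sum≡ = trans (cong sum (E≡ w eq)) (sum-pad (M ∸ sum xs) (act 1 (ones xs) w))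

module Step (j : ℕ) (gowers-j : Gowers j) where

  private
    k = suc j

  raise : List Word → List Word
  raise = map (map suc)

  -- Since `a ≤ j`, the shift `k ∸ a` is one more than `j ∸ a`, and this extra step undoes the
  -- raising of the letters.
  act-raise : ∀ F {w} → Bounded j w → act k (raise F) w ≡ act j F w
  act-raise [] pw = refl
  act-raise (b ∷ F) [] = refl
  act-raise (b ∷ F) (_∷_ {a} a≤j pw) = cong₂ _++_
    (trans (sym (map-∘ b)) (map-cong (λ y → cong (suc y ∸_) (+-∸-assoc 1 a≤j)) b))
    (act-raise F pw)

  length-raise : ∀ F → length (concat (raise F)) ≡ length (concat F)
  length-raise F = trans (cong length (concat-map F)) (length-map suc (concat F))

  -- The induction hypothesis moved to blocks with maximum `k`: it settles the words with maximum
  -- `j` and is the input of the fusion.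
  raised : Arrow k (W k) (Both (W j))
  raised m r with gowers-j m r
  ... | n , arrow = n , λ c →
    let (F , hom) = arrow c
        H = subspace (raise (blocks F)) (trans (length-map _ (blocks F)) (dim F))
              (trans (length-raise (blocks F)) (size F)) (All.map⁺ (All.map lift (valid F)))
    in H , λ eq (p , p′ , e) → trans (cong c (act-raise (blocks F) (proj₁ p)))
             (trans (hom eq (p , p′ , e)) (sym (cong c (act-raise (blocks F) (proj₁ p′)))))
    where
    lift : ∀ {b} → W j b → W k (map suc b)
    lift (pb , j∈b) = All.map⁺ (All.map s≤s pb) , ∈-map⁺ suc j∈b

  open Fusion {k} {W k} {W j} proj₁ (W-closed ≤-refl) (W-closed (n≤1+n j)) W-letter

  -- Between two consecutive letters k of a word expanded by hills there is a factor with maximum j.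
  hill : Word
  hill = j ∷ k ∷ j ∷ []

  hills : ∀ m → Subspace k (W k) m (m * 3)
  hills m = subspace (replicate m hill) (length-replicate m) (size′ m)
    (All.replicate⁺ m (n≤1+n j ∷ ≤-refl ∷ n≤1+n j ∷ [] , there (here refl)))
    where
    size′ : ∀ m → length (concat (replicate m hill)) ≡ m * 3
    size′ zero = refl
    size′ (suc m) = cong (3 +_) (size′ m)

  -- The indicator of a = k on letters a ≤ k.
  χ : ℕ → ℕ
  χ a = 1 ∸ (k ∸ a)

  -- Letters `k` are kept and smaller ones become 0. The detour through `χ` exhibits the binary word
  -- to which `gowers-1` is applied.
  flat : Word → Word
  flat = map (k *_) ∘ map χ

  expand : Word → Word
  expand w = act k (replicate (length w) hill) w

  _~_ : Rel Word 0ℓ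
  _~_ = Star (Factor (W j))

  replace : ∀ {x x′} v → W j x → W j x′ → length x ≡ length x′ → (x ++ v) ~ (x′ ++ v)
  replace v p p′ eq = front (prefix-++ v (whole (p , p′ , eq))) ◅ ε

  prepend : ∀ u {v v′} → v ~ v′ → (u ++ v) ~ (u ++ v′)
  prepend [] p = p
  prepend (a ∷ u) p = gmap (a ∷_) (cons a) (prepend u p)

  data Letter : ℕ → Set where
    top : Letter k
    low : ∀ {a} → a ≤ j → Letter a

  letter : ∀ {a} → a ≤ k → Letter a
  letter {a} a≤k with m≤n⇒m<n∨m≡n a≤k
  ... | inj₁ (s≤s a≤j) = low a≤j
  ... | inj₂ refl = top

  χ-top : k * χ k ≡ k
  χ-top = trans (cong (λ t → k * (1 ∸ t)) (n∸n≡0 k)) (*-identityʳ k)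

  χ-low : ∀ {a} → a ≤ j → k * χ a ≡ 0
  χ-low {a} a≤j = trans
    (cong (k *_) (trans (cong (1 ∸_) (+-∸-assoc 1 a≤j)) (0∸n≡0 (j ∸ a)))) (*-zeroʳ k)

  low-hill : ∀ {a} → a ≤ j → Bounded j (shift (k ∸ a) hill)
  low-hill a≤j = All.map (λ p → ≤-trans p a≤j)
    (bounded-shift (n≤1+n j ∷ ≤-refl ∷ n≤1+n j ∷ []) (m≤n⇒m≤1+n a≤j))

  W-++ : ∀ {x y} → W j x → Bounded j y → W j (x ++ y)
  W-++ (px , j∈x) py = All.++⁺ px py , ∈-++⁺ˡ j∈x

  -- `x` starts as the final letter `j` of a hill and absorbs the lowered hills that follow. Its
  -- maximum stays `j`, so each absorbed hill can be replaced by zeros together with `x`; at the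
  -- next letter `k` a new `x` begins.
  flatten-after : ∀ {x w} → W j x → Bounded k w → (x ++ expand w) ~ (x ++ expand (flat w))
  flatten-after Wx [] = ε
  flatten-after {x} {a ∷ w} Wx (a≤k ∷ pw) with letter a≤k
  ... | top rewrite χ-top | n∸n≡0 j =
    subst₂ _~_ (++-assoc x (j ∷ k ∷ []) _) (++-assoc x (j ∷ k ∷ []) _)
      (prepend (x ++ j ∷ k ∷ []) (flatten-after W-letter pw))
  ... | low a≤j rewrite χ-low a≤j | m≤n⇒m∸n≡0 (n≤1+n j) | n∸n≡0 j =
    subst₂ _~_ (++-assoc x (shift (k ∸ a) hill) _) (++-assoc x (0 ∷ 0 ∷ 0 ∷ []) _)
      (flatten-after (W-++ Wx (low-hill a≤j)) pw ◅◅
       replace (expand (flat w)) (W-++ Wx (low-hill a≤j)) (W-++ Wx (z≤n ∷ z≤n ∷ z≤n ∷ []))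
         (trans (length-++ x) (sym (length-++ x))))

  -- Before the first letter `k` no `j` need have occurred, so the lowered hills are collected in
  -- `y` until the first letter `j` of an unlowered hill completes a factor with maximum `j`. Such a
  -- hill exists because `k` occurs in `w`.
  flatten-before : ∀ {y w} → Bounded j y → W k w →
                   (y ++ expand w) ~ (replicate (length y) 0 ++ expand (flat w))
  flatten-before {y} {a ∷ w} py (a≤k ∷ pw , k∈) with letter a≤k
  flatten-before {y} {a ∷ w} py (a≤k ∷ pw , k∈) | top rewrite χ-top | n∸n≡0 j =
    subst₂ _~_ (++-assoc y [ j ] _) (++-assoc (replicate (length y) 0) [ j ] _)
      (replace _ (All.++⁺ py (≤-refl ∷ []) , ∈-++⁺ʳ y (here refl))
         (All.++⁺ (All.replicate⁺ (length y) z≤n) (≤-refl ∷ []) , ∈-++⁺ʳ (replicate (length y) 0) (here refl))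
         (trans (length-++ y) (trans (cong (_+ 1) (sym (length-replicate (length y))))
           (sym (length-++ (replicate (length y) 0))))) ◅◅
       prepend (replicate (length y) 0 ++ [ j ]) (gmap (k ∷_) (cons k) (flatten-after W-letter pw)))
  flatten-before {y} {a ∷ w} py (a≤k ∷ pw , here refl) | low a≤j = contradiction a≤j (<-irrefl refl)
  flatten-before {y} {a ∷ w} py (a≤k ∷ pw , there k∈) | low a≤j rewrite χ-low a≤j | m≤n⇒m∸n≡0 (n≤1+n j) | n∸n≡0 j =
    subst₂ _~_ (++-assoc y (shift (k ∸ a) hill) _) zeros
      (flatten-before (All.++⁺ py (low-hill a≤j)) (pw , k∈))
    where
    zeros : replicate (length (y ++ shift (k ∸ a) hill)) 0 ++ expand (flat w)
            ≡ replicate (length y) 0 ++ 0 ∷ 0 ∷ 0 ∷ expand (flat w)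
    zeros = trans (cong (λ l → replicate l 0 ++ expand (flat w)) (length-++ y))
      (trans (cong (_++ expand (flat w)) (replicate-+ (length y) 3 0)) (++-assoc (replicate (length y) 0) _ _))

  flatten : ∀ {w} → W k w → expand w ~ expand (flat w)
  flatten = flatten-before []

  -- The scaled blocks have only the letters 0 and `k`, and a letter `k` lowered by `k ∸ a` is still
  -- `k` exactly when `k ≤ a`. Hence `χ` turns substitution at level `k` into substitution at level
  -- 1.
  χ-act : ∀ {F} w → All (Bounded 1) F → map χ (act k (map (map (k *_)) F) w) ≡ act 1 F (map χ w)
  χ-act w [] = refl
  χ-act [] (_ ∷ _) = refl
  χ-act {b ∷ F} (a ∷ w) (pb ∷ pF) =
    trans (map-++ χ (shift (k ∸ a) (map (k *_) b)) _) (cong₂ _++_ (block pb) (χ-act w pF))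
    where
    block : ∀ {b} → Bounded 1 b → map χ (shift (k ∸ a) (map (k *_) b)) ≡ shift (1 ∸ χ a) b
    block [] = refl
    block {0 ∷ b} (_ ∷ pb) = cong₂ _∷_ value (block pb)
      where
      value : χ (k * 0 ∸ (k ∸ a)) ≡ 0 ∸ (1 ∸ χ a)
      value rewrite *-zeroʳ j | 0∸n≡0 (k ∸ a) | 0∸n≡0 j = sym (0∸n≡0 (1 ∸ χ a))
    block {1 ∷ b} (_ ∷ pb) = cong₂ _∷_ value (block pb)
      where
      value : χ (k * 1 ∸ (k ∸ a)) ≡ 1 ∸ (1 ∸ χ a)
      value rewrite *-identityʳ j | m∸[m∸n]≡n (m∸n≤m k a) = sym (m∸[m∸n]≡n (m∸n≤m 1 (k ∸ a)))
    block {suc (suc _) ∷ b} (s≤s () ∷ _)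

  W-scale : ∀ {b} → W 1 b → W k (map (k *_) b)
  W-scale {b} (pb , 1∈b) =
    All.map⁺ (All.map (λ p → ≤-trans (*-monoʳ-≤ k p) (≤-reflexive (*-identityʳ k))) pb) ,
    subst (_∈ map (k *_) b) (*-identityʳ k) (∈-map⁺ (k *_) 1∈b)

  W-χ : ∀ {w} → W k w → W 1 (map χ w)
  W-χ {w} (pw , k∈w) = All.map⁺ (All.tabulate {xs = w} (λ {a} _ → m∸n≤m 1 (k ∸ a))) ,
    subst (_∈ map χ w) (cong (1 ∸_) (n∸n≡0 j)) (∈-map⁺ χ k∈w)

  -- `H` composes `G`, the hills and the scaled blocks of `E`. Flattening moves every word of its
  -- space, without changing the colour, to the expansion of a scaled binary word in the space of
  -- `E`, where `hom-1` applies.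
  gowers-k : Gowers k
  gowers-k m r with gowers-1 m r
  -- Each of the `M` letters expands to a hill of three letters.
  ... | M , arrow-1 with to-factor (to-prefix raised) (M * 3) r
  ... | n , arrow-k = n , step
    where
    step : (c : Word → Fin r) → Σ[ F ∈ Subspace k (W k) m n ]
           (∀ {w w′} → length w ≡ m → Both (W k) w w′ → c (F ∙ w) ≡ c (F ∙ w′))
    step c with arrow-k c
    ... | G , hom with arrow-1 (λ w → c (G ∙ expand (map (k *_) w)))
    ... | E , hom-1
      with composeW (hills M) (subspace (map (map (k *_)) (blocks E)) (trans (length-map _ (blocks E)) (dim E))
             (trans (trans (cong length (concat-map (blocks E))) (length-map (k *_) (concat (blocks E)))) (size E))
             (All.map⁺ (All.map W-scale (valid E))))
    ... | D , D≡ with composeW G D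
    ... | H , H≡ = H , λ {w} {w′} eq (p , p′ , e) → trans (colour w eq p) (trans
            (hom-1 (trans (length-map χ w) eq)
              (W-χ p , W-χ p′ , trans (length-map χ w) (trans e (sym (length-map χ w′)))))
            (sym (colour w′ (trans (sym e) eq) p′)))
      where
      Es = map (map (k *_)) (blocks E)
      colour : ∀ w → length w ≡ m → W k w → c (H ∙ w) ≡ c (G ∙ expand (map (k *_) (E ∙ map χ w)))
      colour w eq p = begin
        c (H ∙ w)            ≡⟨ cong c (H≡ w eq) ⟩
        c (G ∙ (D ∙ w))      ≡⟨ cong (λ v → c (G ∙ v)) (D≡ w eq) ⟩
        c (G ∙ (hills M ∙ z)) ≡⟨ cong (λ l → c (G ∙ act k (replicate l hill) z)) (sym length-z) ⟩
        c (G ∙ expand z)     ≡⟨ star-invariant {c = c} {G ∙_} hom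
                                  (trans (length-∙ (hills (length z)) z refl) (cong (_* 3) length-z)) (flatten Wz) ⟩
        c (G ∙ expand (flat z)) ≡⟨ cong (λ v → c (G ∙ expand (map (k *_) v))) (χ-act w (All.map proj₁ (valid E))) ⟩
        c (G ∙ expand (map (k *_) (E ∙ map χ w))) ∎
        where
        open ≡-Reasoning
        z = act k Es w
        length-z : length z ≡ M
        length-z = trans (length-act k Es w (trans (length-map _ (blocks E)) (trans (dim E) (sym eq))))
          (trans (cong length (concat-map (blocks E))) (trans (length-map (k *_) (concat (blocks E))) (size E)))
        Wz : W k z
        Wz = W-closed ≤-refl w (All.map⁺ (All.map W-scale (valid E)))
               (trans (length-map _ (blocks E)) (trans (dim E) (sym eq))) p

-- The induction starts at 0, where words of equal length with maximum 0 coincide.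
gowers : ∀ k → Gowers k
gowers zero m r = m , λ c →
  subspace (replicate m [ 0 ]) (length-replicate m) (size′ m) (All.replicate⁺ m W-letter) ,
  λ {w} {w′} _ (p , p′ , e) → cong (λ v → c (act 0 (replicate m [ 0 ]) v)) (zeros-unique (proj₁ p) (proj₁ p′) e)
  where
  size′ : ∀ m → length (concat (replicate m [ 0 ])) ≡ m
  size′ zero = refl
  size′ (suc m) = cong suc (size′ m)
  zeros-unique : ∀ {w w′} → Bounded 0 w → Bounded 0 w′ → length w ≡ length w′ → w ≡ w′
  zeros-unique [] [] _ = refl
  zeros-unique (z≤n ∷ p) (z≤n ∷ p′) e = cong (0 ∷_) (zeros-unique p p′ (suc-injective e))
gowers (suc j) = Step.gowers-k j (gowers j)

-- Words as elements of FIN k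

nth : Word → ℕ → ℕ
nth [] x = 0
nth (a ∷ w) zero = a
nth (a ∷ w) (suc x) = nth w x

nth-≤ : ∀ {k w} → Bounded k w → ∀ x → nth w x ≤ k
nth-≤ [] x = z≤n
nth-≤ (p ∷ pw) zero = p
nth-≤ (p ∷ pw) (suc x) = nth-≤ pw x

nth-∈ : ∀ {a w} → a ∈ w → ∃[ x ] nth w x ≡ a
nth-∈ (here refl) = 0 , refl
nth-∈ (there p) = let (x , eq) = nth-∈ p in suc x , eq

nth-beyond : ∀ w {x} → length w ≤ x → nth w x ≡ 0
nth-beyond [] le = refl
nth-beyond (a ∷ w) (s≤s le) = nth-beyond w le

nth-shift : ∀ t b x → nth (shift t b) x ≡ nth b x ∸ t
nth-shift t [] x = sym (0∸n≡0 t)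
nth-shift t (a ∷ b) zero = refl
nth-shift t (a ∷ b) (suc x) = nth-shift t b x

nth-++ˡ : ∀ v w {x} → x < length v → nth (v ++ w) x ≡ nth v x
nth-++ˡ (a ∷ v) w {zero} lt = refl
nth-++ˡ (a ∷ v) w {suc x} (s≤s lt) = nth-++ˡ v w lt

nth-++ʳ : ∀ v w x → nth (v ++ w) (length v + x) ≡ nth w x
nth-++ʳ [] w x = refl
nth-++ʳ (a ∷ v) w x = nth-++ʳ v w x

IsMax-exists : ∀ n {f : ℕ → ℕ} → (∀ {x} → n ≤ x → f x ≡ 0) → ∀ {x} → f x ≢ 0 → ∃[ a ] IsMax (supp f) a
IsMax-exists zero vanish fx≢0 = contradiction (vanish z≤n) fx≢0
IsMax-exists (suc n) {f} vanish fx≢0 with f n ≟ 0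
... | no fn≢0 = n , fn≢0 , λ y fy≢0 → ≮⇒≥ (λ n<y → fy≢0 (vanish n<y))
... | yes fn≡0 = IsMax-exists n vanish′ fx≢0
  where
  vanish′ : ∀ {x} → n ≤ x → f x ≡ 0
  vanish′ n≤x with m≤n⇒m<n∨m≡n n≤x
  ... | inj₁ n<x = vanish n<x
  ... | inj₂ refl = fn≡0

IsMin-exists : ∀ {f : ℕ → ℕ} x → f x ≢ 0 → ∃[ a ] IsMin (supp f) a
IsMin-exists {f} x fx≢0 with f 0 ≟ 0
IsMin-exists x fx≢0 | no f0≢0 = 0 , f0≢0 , λ _ _ → z≤n
IsMin-exists zero fx≢0 | yes f0≡0 = contradiction f0≡0 fx≢0
IsMin-exists {f} (suc x) fx≢0 | yes f0≡0 with IsMin-exists {f ∘ suc} x fx≢0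
... | a , fa≢0 , least = suc a , fa≢0 , λ where
  zero f0≢0 → contradiction f0≡0 f0≢0
  (suc y) fy≢0 → s≤s (least y fy≢0)

word-FIN : ∀ {k w} → W k w → FIN k
word-FIN {k} {w} (pw , k∈w) = record
  { fun = nth w
  ; bounded = nth-≤ pw
  ; attained = nth-∈ k∈w
  ; finite = upTo (length w) , λ {x} wx≢0 → ∈-upTo⁺ (≰⇒> (λ le → wx≢0 (nth-beyond w le)))
  }

word-max : ∀ {k w} → W (suc k) w → ∃[ a ] IsMax (supp (nth w)) a
word-max {w = w} (_ , k∈w) with nth-∈ k∈w
... | x , wx≡k = IsMax-exists (length w) (nth-beyond w) {x} (λ wx≡0 → contradiction (trans (sym wx≡k) wx≡0) λ ())

word-FIN< : ∀ {k n w} → length w ≡ n → W (suc k) w → FIN< (suc k) n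
word-FIN< {w = w} eq Ww = record
  { elem = word-FIN Ww
  ; max<n = let (a , max) = word-max Ww in a , max , ≰⇒> (λ le → proj₁ max (nth-beyond w (≤-trans (≤-reflexive eq) le)))
  }

-- `Arrow` speaks of colourings of all words. Words outside the domain of `c` get the default colour
-- `zero`, so there must be at least one colour.
extend : ∀ {k n r} → Colouring (suc k) n (suc r) → Word → Fin (suc r)
extend {k} {n} c w with length w ≟ n | All.all? (_≤? suc k) w ×-dec (suc k ∈? w)
... | yes eq | yes Ww = Func.to c (word-FIN< eq Ww)
... | _ | _ = zero

-- The evidence inside `g` may differ from that built from the word; `Func.cong` makes the colour
-- independent of it.
extend-≡ : ∀ {k n r} (c : Colouring (suc k) n (suc r)) {w} g → length w ≡ n → W (suc k) w →
           (∀ x → fun (elem g) x ≡ nth w x) → Func.to c g ≡ extend c w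
extend-≡ {k} {n} c {w} g eq Ww same with length w ≟ n | All.all? (_≤? suc k) w ×-dec (suc k ∈? w)
... | yes _ | yes _ = Func.cong c same
... | no ≢n | _     = contradiction eq ≢n
... | yes _ | no ¬W = contradiction Ww ¬W

-- Members of the combinatorial space as substitutions

offset : (F : List Word) → Fin (length F) → ℕ
offset (b ∷ F) zero = 0
offset (b ∷ F) (suc i) = length b + offset F i

offset-< : ∀ F {i j} → i Fin.< j → offset F i + length (lookup F i) ≤ offset F j
offset-< (b ∷ F) {zero} {suc j} lt = m≤m+n (length b) (offset F j)
offset-< (b ∷ F) {suc i} {suc j} (s≤s lt) = ≤-trans
  (≤-reflexive (+-assoc (length b) (offset F i) _)) (+-monoʳ-≤ (length b) (offset-< F lt))

-- `value` is the letter of the block at position `x`. The field `nth-act` holds for all `g` at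
-- once, so that generators and members can be compared at one position.
record At (k : ℕ) (F : List Word) (x : ℕ) : Set where
  field
    index     : Fin (length F)
    value     : ℕ
    value≤k   : value ≤ k
    offset≤x  : offset F index ≤ x
    x<end     : x < offset F index + length (lookup F index)
    nth-act   : ∀ g → nth (act k F (tabulate g)) x ≡ value ∸ (k ∸ g index)

open At

nth-act-drop : ∀ {k} b F (g : Fin (suc (length F)) → ℕ) x →
               nth (act k (b ∷ F) (tabulate g)) (length b + x) ≡ nth (act k F (tabulate (g ∘ suc))) x
nth-act-drop {k} b F g x =
  trans (cong (λ l → nth (act k (b ∷ F) (tabulate g)) (l + x)) (sym (length-map _ b)))
    (nth-++ʳ (shift (k ∸ g zero) b) _ x)

locate : ∀ {k F} → All (Bounded k) F → ∀ x → (∀ g → nth (act k F (tabulate g)) x ≡ 0) ⊎ At k F x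
locate [] x = inj₁ λ _ → refl
locate {k} {b ∷ F} (pb ∷ pF) x with x <? length b
... | yes lt = inj₂ record
  { index = zero ; value = nth b x ; value≤k = nth-≤ pb x ; offset≤x = z≤n ; x<end = lt
  ; nth-act = λ g → trans
      (nth-++ˡ (shift (k ∸ g zero) b) _ (subst (x <_) (sym (length-map _ b)) lt)) (nth-shift (k ∸ g zero) b x)
  }
... | no ≮ with m≤n⇒∃[o]m+o≡n (≮⇒≥ ≮)
...   | y , refl with locate pF y
...     | inj₁ outside = inj₁ λ g → trans (nth-act-drop b F g y) (outside (g ∘ suc))
...     | inj₂ at = inj₂ record
  { index = suc (index at) ; value = value at ; value≤k = value≤k at
  ; offset≤x = +-monoʳ-≤ (length b) (offset≤x at)
  ; x<end = subst (length b + y <_) (sym (+-assoc (length b) _ _)) (+-monoʳ-< (length b) (x<end at))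
  ; nth-act = λ g → trans (nth-act-drop b F g y) (nth-act at (g ∘ suc))
  }

sumᶠ-zeros : ∀ {p} (t : Fin p → ℕ) → (∀ a → t a ≡ 0) → sumᶠ +-0-monoid t ≡ 0
sumᶠ-zeros {zero} t zeros = refl
sumᶠ-zeros {suc p} t zeros = cong₂ _+_ (zeros zero) (sumᶠ-zeros (t ∘ suc) (zeros ∘ suc))

sumᶠ-single : ∀ {p} (t : Fin p → ℕ) a → (∀ b → b ≢ a → t b ≡ 0) → sumᶠ +-0-monoid t ≡ t a
sumᶠ-single t zero zeros = trans
  (cong (t zero +_) (sumᶠ-zeros (t ∘ suc) (λ b → zeros (suc b) λ ()))) (+-identityʳ (t zero))
sumᶠ-single t (suc a) zeros = cong₂ _+_ (zeros zero λ ())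
  (sumᶠ-single (t ∘ suc) a (λ b b≢a → zeros (suc b) (b≢a ∘ Fin.suc-injective)))

T^-∸ : ∀ l f x → T^ l f x ≡ f x ∸ l
T^-∸ zero f x = refl
T^-∸ (suc l) f x = trans (cong (_∸ 1) (T^-∸ l f x)) (trans (∸-+-assoc (f x) l 1) (cong (f x ∸_) (+-comm l 1)))

module Blocks {j : ℕ} (F : List Word) (vF : All (W (suc j)) F) where

  private
    k = suc j
    m = length F

  -- Substituting `unit i` keeps the block with index `i` and erases all others, which gives the
  -- i-th generator in its place.
  unit : Fin m → Fin m → ℕ
  unit i i′ with i Fin.≟ i′
  ... | yes _ = k
  ... | no _ = 0

  unit-same : ∀ i → unit i i ≡ k
  unit-same i with i Fin.≟ i
  ... | yes _ = refl
  ... | no ≢ = contradiction refl ≢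

  unit-other : ∀ {i i′} → i ≢ i′ → unit i i′ ≡ 0
  unit-other {i} {i′} i≢i′ with i Fin.≟ i′
  ... | yes eq = contradiction eq i≢i′
  ... | no _ = refl

  unit-≤ : ∀ i i′ → unit i i′ ≤ k
  unit-≤ i i′ with i Fin.≟ i′
  ... | yes _ = ≤-refl
  ... | no _ = z≤n

  substitute : (Fin m → ℕ) → Word
  substitute g = act k F (tabulate g)

  length-substitute : ∀ g → length (substitute g) ≡ length (concat F)
  length-substitute g = length-act k F (tabulate g) (sym (length-tabulate g))

  W-tabulate : ∀ {g : Fin m → ℕ} → (∀ i → g i ≤ k) → (∃[ i ] g i ≡ k) → W k (tabulate g)
  W-tabulate {g} bounded (i , gi≡k) = All.tabulate⁺ bounded , subst (_∈ tabulate g) gi≡k (∈-tabulate⁺ {f = g} i)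

  W-substitute : ∀ {g} → W k (tabulate g) → W k (substitute g)
  W-substitute {g} = W-closed ≤-refl (tabulate g) vF (sym (length-tabulate g))

  W-block : ∀ i → W k (substitute (unit i))
  W-block i = W-substitute (W-tabulate (unit-≤ i) (i , unit-same i))

  block : Fin m → FIN< k (length (concat F))
  block i = word-FIN< (length-substitute (unit i)) (W-block i)

  at-block : ∀ {i x} → nth (substitute (unit i)) x ≢ 0 →
             offset F i ≤ x × x < offset F i + length (lookup F i)
  at-block {i} {x} ≢0 with locate (All.map proj₁ vF) x
  ... | inj₁ outside = contradiction (outside (unit i)) ≢0
  ... | inj₂ at with i Fin.≟ index at
  ...   | yes refl = offset≤x at , x<end at
  ...   | no i≢ = contradiction (trans (nth-act at (unit i))
            (trans (cong (λ a → value at ∸ (k ∸ a)) (unit-other i≢)) (m≤n⇒m∸n≡0 (value≤k at)))) ≢0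

  block-sequence : IsBlockSequence (elem ∘ block)
  block-sequence i i′ i<i′ with word-max (W-block i) | nth-∈ (proj₂ (W-block i′))
  ... | a , max | x , eq with IsMin-exists {nth (substitute (unit i′))} x (λ ≡0 → contradiction (trans (sym eq) ≡0) λ ())
  ... | b , min = a , b , max , min ,
    <-≤-trans (proj₂ (at-block (proj₁ max))) (≤-trans (offset-< F i<i′) (proj₁ (at-block (proj₁ min))))

  module Member {g} (member : ⟨ elem ∘ block ⟩ g) where
    open ⟨_⟩ member

    i-injective : ∀ {a b} → i a ≡ i b → a ≡ b
    i-injective {a} {b} eq with Fin.<-cmp a b
    ... | tri< a<b _ _ = contradiction (cong toℕ eq) (<⇒≢ (increasing a b a<b))
    ... | tri≈ _ a≡b _ = a≡b
    ... | tri> _ _ b<a = contradiction (cong toℕ (sym eq)) (<⇒≢ (increasing b a b<a))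

    letters : Fin m → ℕ
    letters i′ with any? (λ a → i a Fin.≟ i′)
    ... | yes (a , _) = k ∸ l a
    ... | no _ = 0

    letters-i : ∀ a → letters (i a) ≡ k ∸ l a
    letters-i a with any? (λ b → i b Fin.≟ i a)
    ... | yes (b , eq) = cong (λ z → k ∸ l z) (i-injective eq)
    ... | no ∄ = contradiction (a , refl) ∄

    letters-outside : ∀ {i′} → (∀ a → i a ≢ i′) → letters i′ ≡ 0
    letters-outside {i′} outside with any? (λ a → i a Fin.≟ i′)
    ... | yes (a , eq) = contradiction eq (outside a)
    ... | no _ = refl

    letters-≤ : ∀ i′ → letters i′ ≤ k
    letters-≤ i′ with any? (λ a → i a Fin.≟ i′)
    ... | yes (a , _) = m∸n≤m k (l a)
    ... | no _ = z≤n

    W-letters : W k (tabulate letters)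
    W-letters = W-tabulate letters-≤ (i a , trans (letters-i a) (cong (k ∸_) la≡0))
      where
      a = proj₁ (proj₁ min-l≡0)
      la≡0 = proj₂ (proj₁ min-l≡0)

    private
      term : ℕ → Fin p → ℕ
      term x a = T^ (l a) (fun (elem (block (i a)))) x

      vanish : ∀ {x a} → nth (substitute (unit (i a))) x ≡ 0 → term x a ≡ 0
      vanish {x} {a} eq = trans (T^-∸ (l a) _ x) (trans (cong (_∸ l a) eq) (0∸n≡0 (l a)))

    -- The generators have disjoint supports, so at `x` only the term of the block containing `x`
    -- can be nonzero, and `∸∸-swap` identifies its value.
    is-substitute : ∀ x → g x ≡ nth (substitute letters) x
    is-substitute x with locate (All.map proj₁ vF) x
    ... | inj₁ outside =
      trans (is-sum x) (trans (sumᶠ-zeros (term x) (λ a → vanish (outside (unit (i a))))) (sym (outside letters)))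
    ... | inj₂ at = trans (is-sum x) (trans (cases (any? (λ a → i a Fin.≟ index at))) (sym (nth-act at letters)))
      where
      open ≡-Reasoning
      y = value at
      elsewhere : ∀ {b} → i b ≢ index at → term x b ≡ 0
      elsewhere {b} ≢ = vanish (trans (nth-act at (unit (i b)))
        (trans (cong (λ z → y ∸ (k ∸ z)) (unit-other ≢)) (m≤n⇒m∸n≡0 (value≤k at))))
      cases : Dec (∃[ a ] i a ≡ index at) → sumᶠ +-0-monoid (term x) ≡ y ∸ (k ∸ letters (index at))
      cases (yes (a , eq)) = begin
        sumᶠ +-0-monoid (term x)
          ≡⟨ sumᶠ-single (term x) a (λ b b≢a → elsewhere (λ e → b≢a (i-injective (trans e (sym eq))))) ⟩
        term x a                                 ≡⟨ T^-∸ (l a) _ x ⟩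
        nth (substitute (unit (i a))) x ∸ l a    ≡⟨ cong (_∸ l a) (nth-act at (unit (i a))) ⟩
        y ∸ (k ∸ unit (i a) (index at)) ∸ l a
          ≡⟨ cong (λ z → y ∸ (k ∸ z) ∸ l a) (trans (cong (unit (i a)) (sym eq)) (unit-same (i a))) ⟩
        y ∸ (k ∸ k) ∸ l a                        ≡⟨ ∸∸-swap (l a) ≤-refl (value≤k at) ⟩
        y ∸ (k ∸ (k ∸ l a))
          ≡⟨ cong (λ z → y ∸ (k ∸ z)) (trans (cong letters (sym eq)) (letters-i a)) ⟨
        y ∸ (k ∸ letters (index at))             ∎
      cases (no ∄) = begin
        sumᶠ +-0-monoid (term x)       ≡⟨ sumᶠ-zeros (term x) (λ a → elsewhere (λ e → ∄ (a , e))) ⟩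
        0                             ≡⟨ m≤n⇒m∸n≡0 (value≤k at) ⟨
        y ∸ k                         ≡⟨ cong (λ z → y ∸ (k ∸ z)) (letters-outside (λ a e → ∄ (a , e))) ⟨
        y ∸ (k ∸ letters (index at))  ∎

theorem1 : (m k r : ℕ) → k ≥ 1 →
    ∃[ n ] ((c : Colouring k n r) →
    Σ[ f ∈ (Fin m → FIN< k n) ]
    (IsBlockSequence (elem ∘ f) × IsConstantOn c ⟨ elem ∘ f ⟩))
-- Without colours no colouring exists once the domain is inhabited; for `n = 1` it contains the
-- one-letter word `suc j`.
theorem1 m (suc j) zero _ = 1 , λ c → contradiction (Func.to c (word-FIN< {w = [ suc j ]} refl W-letter)) λ ()
theorem1 m (suc j) (suc r) _ with gowers (suc j) m (suc r)
... | n , arrow = n , λ c → solve c (arrow (extend c))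
  where
  k = suc j
  solve : ∀ {m n} (c : Colouring k n (suc r)) →
          Σ[ F ∈ Subspace k (W k) m n ] (∀ {w w′} → length w ≡ m → Both (W k) w w′ →
            extend c (F ∙ w) ≡ extend c (F ∙ w′)) →
          Σ[ f ∈ (Fin m → FIN< k n) ] (IsBlockSequence (elem ∘ f) × IsConstantOn c ⟨ elem ∘ f ⟩)
  solve c (subspace F refl refl vF , hom) = block , block-sequence , λ g h Sg Sh →
    trans (colour g Sg) (trans
      (hom (length-tabulate (letters Sg))
        (W-letters Sg , W-letters Sh , trans (length-tabulate (letters Sg)) (sym (length-tabulate (letters Sh)))))
      (sym (colour h Sh)))
    where
    open Blocks F vF
    open Member using (letters; W-letters; is-substitute)
    colour : ∀ g (Sg : ⟨ elem ∘ block ⟩ (fun (elem g))) →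
             Func.to c g ≡ extend c (substitute (letters Sg))
    colour g Sg = extend-≡ c g (length-substitute (letters Sg)) (W-substitute (W-letters Sg)) (is-substitute Sg)
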